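{- Let $k\ge2$ and let $\mathcal{H}=(V,E)$ be a $k$-uniform linear hypergraph with $n$ vertices satisfying $n\le k^2+k-2$. Then $\mathrm{q}(\mathcal{H})\le \Delta([\mathcal{H}]_2)+1$.
   Context: A hypergraph $\mathcal{H}=(V,E)$ has a finite vertex set $V$ and a finite set $E$ of nonempty subsets of $V$ (hyperedges); linear means distinct hyperedges share at most one vertex; $k$-uniform means every hyperedge has $k$ elements. The 2-section $[\mathcal{H}]_2$ is the simple graph on $V$ where distinct vertices are adjacent iff some hyperedge contains both; $\Delta([\mathcal{H}]_2)$ is its maximum degree. The chromatic index $\mathrm{q}(\mathcal{H})$ is the least number of colors in a coloring of hyperedges where distinct intersecting hyperedges get different colors. -}

module Defs where

open import Data.Fin.Base using (Fin; finToFun; funToFin)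
import Data.Fin.Properties as Fin
open import Data.Fin.Subset using (Subset; _∈_; _∩_; ∣_∣; Nonempty)
open import Data.Fin.Subset.Properties using (_∈?_; nonempty?)
open import Data.List.Base using (List; length; lookup; filter; map; allFin)
open import Data.List.Extrema.Nat using (max)
import Data.List.Membership.Propositional as List
open import Data.List.Relation.Unary.All using (All)
open import Data.List.Relation.Unary.Any as Any using (Any)
open import Data.List.Relation.Unary.Unique.Propositional using (Unique)
open import Data.Nat.Base using (ℕ; zero; suc; _≤_; z≤n; s≤s)
open import Data.Product.Base using (∃; _×_; _,_; proj₁; proj₂)
open import Function.Base using (_∘_; id)
open import Relation.Binary.Core using (Rel)
open import Relation.Binary.Definitions using (Symmetric; Irreflexive; Decidable)
open import Relation.Binary.PropositionalEquality
  using (_≡_; _≢_; sym; trans; ≢-sym)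
open import Relation.Nullary using (Dec; yes; no; ¬_; contradiction)
open import Relation.Nullary.Decidable using (map′; _×-dec_; _→-dec_; ¬?)
import Relation.Unary as Unary
open import Level using (0ℓ)

private
  variable
    n : ℕ

-- The list of hyperedges stands for a set: Unique rules out repetitions, and
-- no definition below depends on the order.
record Hypergraph (n : ℕ) : Set where
  field
    E        : List (Subset n)
    distinct : Unique E
    nonempty : All Nonempty E

  -- By distinctness, positions in E correspond bijectively to hyperedges.
  Edge : Set
  Edge = Fin (length E)

  edge : Edge → Subset n
  edge = lookup E

open Hypergraph

Uniform : ℕ → Hypergraph n → Set
Uniform k H = ∀ {e} → e List.∈ E H → ∣ e ∣ ≡ k

Linear : Hypergraph n → Set
Linear H = ∀ {e f} → e List.∈ E H → f List.∈ E H → e ≢ f → ∣ e ∩ f ∣ ≤ 1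

record SimpleGraph (n : ℕ) : Set₁ where
  infix 4 _~_ _~?_
  field
    _~_      : Rel (Fin n) 0ℓ
    ~-sym    : Symmetric _~_
    ~-irrefl : Irreflexive _≡_ _~_
    _~?_     : Decidable _~_

  degree : Fin n → ℕ
  degree v = length (filter (v ~?_) (allFin n))

-- The maximum degree, taken to be 0 when there are no vertices.
Δ : SimpleGraph n → ℕ
Δ {n} G = max 0 (map (SimpleGraph.degree G) (allFin n))

[_]₂ : Hypergraph n → SimpleGraph n
[ H ]₂ = record
  { _~_      = λ u v → u ≢ v × Any (λ e → u ∈ e × v ∈ e) (E H)
  ; ~-sym    = λ (u≢v , p) → ≢-sym u≢v , Any.map (λ (u∈e , v∈e) → v∈e , u∈e) p
  ; ~-irrefl = λ u≡v (u≢v , _) → u≢v u≡v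
  ; _~?_     = λ u v → ¬? (u Fin.≟ v) ×-dec Any.any? (λ e → u ∈? e ×-dec v ∈? e) (E H)
  }

Proper : (H : Hypergraph n) {m : ℕ} → (Edge H → Fin m) → Set
Proper H c = ∀ i j → i ≢ j → Nonempty (edge H i ∩ edge H j) → c i ≢ c j

Colourable : Hypergraph n → ℕ → Set
Colourable H m = ∃ λ (c : Edge H → Fin m) → Proper H c

IsLeast : (ℕ → Set) → ℕ → Set
IsLeast P q = P q × (∀ m → P m → q ≤ m)

proper? : (H : Hypergraph n) {m : ℕ} (c : Edge H → Fin m) → Dec (Proper H c)
proper? H c = Fin.all? λ i → Fin.all? λ j →
  ¬? (i Fin.≟ j) →-dec nonempty? (edge H i ∩ edge H j) →-dec ¬? (c i Fin.≟ c j)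

-- Search through all maps Edge H → Fin m, coded as elements of Fin (m ^ length E).
colourable? : (H : Hypergraph n) → Unary.Decidable (Colourable H)
colourable? H m = map′ to from (Fin.any? λ x → proper? H (finToFun x))
  where
  to : ∃ (λ x → Proper H (finToFun {m} x)) → Colourable H m
  to (x , p) = finToFun x , p

  from : Colourable H m → ∃ λ x → Proper H (finToFun {m} x)
  from (c , p) = funToFin c , λ i j i≢j i∩j eq → p i j i≢j i∩j
    (trans (sym (Fin.finToFun-funToFin c i)) (trans eq (Fin.finToFun-funToFin c j)))

colourable-size : (H : Hypergraph n) → Colourable H (length (E H))
colourable-size H = id , λ _ _ i≢j _ → i≢j

least : {P : ℕ → Set} → Unary.Decidable P → ∀ m → P m → ∃ (IsLeast P)
least P? zero    p = zero , p , λ _ _ → z≤n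
least {P} P? (suc m) p with P? zero
... | yes p₀ = zero , p₀ , λ _ _ → z≤n
... | no ¬p₀ with least (P? ∘ suc) m p
...   | q , pq , min = suc q , pq , lower
  where
  lower : ∀ m → P m → suc q ≤ m
  lower zero    p₀ = contradiction p₀ ¬p₀
  lower (suc m) pm = s≤s (min m pm)

leastColours : (H : Hypergraph n) → ∃ (IsLeast (Colourable H))
leastColours H = least (colourable? H) (length (E H)) (colourable-size H)

chromaticIndex : Hypergraph n → ℕ
chromaticIndex = proj₁ ∘ leastColours

chromaticIndex-isLeast : (H : Hypergraph n) → IsLeast (Colourable H) (chromaticIndex H)
chromaticIndex-isLeast = proj₂ ∘ leastColours

{-# OPTIONS --safe #-}
module Submission where

-- Write k = l + 1, and D for the maximum degree of the 2-section; a point on d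
-- hyperedges has degree d l there, so d l ≤ D. Remove a hyperedge with at most D
-- neighbours, colour the rest by induction and extend greedily. When no such
-- hyperedge is left, Σ_{v ∈ e} deg v ≥ (D + 1) + k for every e; multiplying by l
-- gives D ≥ l (l + 2), while n ≤ k² + k - 2 gives deg v ≤ l + 2, so equality holds
-- throughout and every covered point has degree l + 2. The number of covered
-- points is then a multiple of l + 1 between (l + 1)² and (l + 1)² + l - 1, hence
-- equal to (l + 1)²: the remaining hyperedges form an affine plane of order k, and
-- its k + 1 parallel classes are a proper colouring with few enough colours.

open import Defs
open import Data.Bool.Base using (true; false; if_then_else_)
open import Data.Bool.Properties using () renaming (_≟_ to _≟ᵇ_)
open import Data.Empty using (⊥)
open import Data.Fin.Base as Fin using (Fin; inject≤)
import Data.Fin.Properties as Fin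
open import Data.Fin.Subset using (Subset; _∈_; _∩_; ∣_∣; Nonempty; inside; outside)
open import Data.Fin.Subset.Properties
  using (_∈?_; nonempty?; x∈p∩q⁺; x∈p∩q⁻; ∩-comm; ∩-idem)
open import Data.List.Base
  using (List; []; _∷_; length; lookup; filter; map; allFin; tabulate)
open import Data.List.Extrema.Nat using (xs≤max)
import Data.List.Membership.Propositional as List
open import Data.List.Membership.Propositional using (find; lose)
open import Data.List.Membership.Propositional.Properties
  using (∈-allFin; ∈-lookup; ∈-filter⁺; ∈-filter⁻; ∈-map⁺)
import Data.List.Membership.DecPropositional as DecMembership
open import Data.List.Properties using (map-tabulate; filter-notAll; length-map; length-tabulate)
open import Data.List.Relation.Unary.All as All using (All; []; _∷_)
open import Data.List.Relation.Unary.AllPairs using ([]; _∷_)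
open import Data.List.Relation.Unary.Any as Any using (Any; here; there; index)
open import Data.List.Relation.Unary.Any.Properties using (lookup-index)
open import Data.List.Relation.Unary.Unique.Propositional using (Unique)
import Data.List.Relation.Unary.Unique.Propositional.Properties as Unique
open import Data.Nat.Base
open import Data.Nat.Divisibility using (_∣_; divides; ∣m+n∣m⇒∣n; m∣m*n; >⇒∤)
open import Data.Nat.ListAction using (sum)
open import Data.Nat.Properties
open import Data.Nat.Tactic.RingSolver using (solve-∀)
open import Data.Product.Base using (∃; _×_; _,_; proj₁; proj₂)
open import Data.Sum.Base using (_⊎_; inj₁; inj₂)
open import Data.Vec.Base using ([]; _∷_)
import Data.Vec.Properties as Vec
open import Function.Base using (_∘_; case_returning_of_)
open import Relation.Binary.Definitions using (DecidableEquality)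
open import Relation.Binary.PropositionalEquality
  using (_≡_; _≢_; refl; sym; trans; cong; cong₂; subst; ≢-sym; module ≡-Reasoning)
open import Relation.Nullary using (Dec; yes; no; does; ¬_; contradiction)
open import Relation.Nullary.Decidable using (_×-dec_; _⊎-dec_; ¬?)
import Relation.Unary as Unary

private
  variable
    A B P Q : Set

-- Finite sums over lists

∑ : List A → (A → ℕ) → ℕ
∑ xs f = sum (map f xs)

infix 5 ∑
syntax ∑ xs (λ x → t) = ∑[ x ∈ xs ] t

module _ {f g : A → ℕ} where

  ∑-mono : ∀ {xs} → (∀ {x} → x List.∈ xs → f x ≤ g x) → ∑ xs f ≤ ∑ xs g
  ∑-mono {[]}     f≤g = z≤n
  ∑-mono {x ∷ xs} f≤g = +-mono-≤ (f≤g (here refl)) (∑-mono (f≤g ∘ there))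

  ∑-cong : ∀ {xs} → (∀ {x} → x List.∈ xs → f x ≡ g x) → ∑ xs f ≡ ∑ xs g
  ∑-cong {[]}     f≡g = refl
  ∑-cong {x ∷ xs} f≡g = cong₂ _+_ (f≡g (here refl)) (∑-cong (f≡g ∘ there))

  -- A strict inequality at a single entry would make the totals strictly ordered. This is the tool
  -- that turns tight counting bounds into pointwise equalities.
  ∑-tight : ∀ {xs} → (∀ {x} → x List.∈ xs → f x ≤ g x) → ∑ xs g ≤ ∑ xs f →
            ∀ {x} → x List.∈ xs → f x ≡ g x
  ∑-tight {x ∷ xs} f≤g Σg≤Σf (here refl) =
    ≤-antisym (f≤g (here refl))
      (+-cancelʳ-≤ (∑ xs g) (g x) (f x)
        (≤-trans Σg≤Σf (+-monoʳ-≤ (f x) (∑-mono (f≤g ∘ there)))))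
  ∑-tight {x ∷ xs} f≤g Σg≤Σf (there x∈xs) =
    ∑-tight (f≤g ∘ there)
      (+-cancelˡ-≤ (g x) _ _
        (≤-trans Σg≤Σf (+-monoˡ-≤ (∑ xs f) (f≤g (here refl)))))
      x∈xs

  ∑-+ : ∀ xs → (∑[ x ∈ xs ] (f x + g x)) ≡ ∑ xs f + ∑ xs g
  ∑-+ []       = refl
  ∑-+ (x ∷ xs) = trans (cong (f x + g x +_) (∑-+ xs))
    (interchange (f x) (g x) (∑ xs f) (∑ xs g))
    where
    interchange : ∀ a b c d → a + b + (c + d) ≡ a + c + (b + d)
    interchange = solve-∀

module _ {f : A → ℕ} where

  ∑-*ˡ : ∀ c xs → (∑[ x ∈ xs ] c * f x) ≡ c * ∑ xs f
  ∑-*ˡ c []       = sym (*-zeroʳ c)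
  ∑-*ˡ c (x ∷ xs) = trans (cong (c * f x +_) (∑-*ˡ c xs)) (sym (*-distribˡ-+ c (f x) _))

  ∑-*ʳ : ∀ c xs → (∑[ x ∈ xs ] f x * c) ≡ ∑ xs f * c
  ∑-*ʳ c []       = refl
  ∑-*ʳ c (x ∷ xs) = trans (cong (f x * c +_) (∑-*ʳ c xs)) (sym (*-distribʳ-+ c (f x) _))

∑-filter : ∀ {P : A → Set} (P? : Unary.Decidable P) {f : A → ℕ} xs → ∑ (filter P? xs) f ≤ ∑ xs f
∑-filter P? []           = z≤n
∑-filter P? {f} (x ∷ xs) with does (P? x)
... | true  = +-monoʳ-≤ (f x) (∑-filter P? xs)
... | false = ≤-trans (∑-filter P? xs) (m≤n+m _ (f x))

∑-const : ∀ c (xs : List A) → (∑[ _ ∈ xs ] c) ≡ length xs * c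
∑-const c []       = refl
∑-const c (x ∷ xs) = cong (c +_) (∑-const c xs)

∑-swap : ∀ (f : A → B → ℕ) xs ys →
         (∑[ x ∈ xs ] ∑[ y ∈ ys ] f x y) ≡ (∑[ y ∈ ys ] ∑[ x ∈ xs ] f x y)
∑-swap f []       ys = sym (trans (∑-const 0 ys) (*-zeroʳ (length ys)))
∑-swap f (x ∷ xs) ys = trans (cong (∑ ys (f x) +_) (∑-swap f xs ys)) (sym (∑-+ ys))

-- Indicators and counting

𝟙 : Dec P → ℕ
𝟙 P? = if does P? then 1 else 0

𝟙-yes : (P? : Dec P) → P → 𝟙 P? ≡ 1
𝟙-yes (yes _) p = refl
𝟙-yes (no ¬p) p = contradiction p ¬p

𝟙-no : (P? : Dec P) → ¬ P → 𝟙 P? ≡ 0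
𝟙-no (yes p) ¬p = contradiction p ¬p
𝟙-no (no _)  ¬p = refl

𝟙-holds : (P? : Dec P) → 𝟙 P? ≡ 1 → P
𝟙-holds (yes p) _ = p

𝟙-× : (P? : Dec P) (Q? : Dec Q) → 𝟙 (P? ×-dec Q?) ≡ 𝟙 P? * 𝟙 Q?
𝟙-× (yes _) Q? = sym (+-identityʳ (𝟙 Q?))
𝟙-× (no _)  Q? = refl

𝟙-¬ : (P? : Dec P) → 𝟙 P? + 𝟙 (¬? P?) ≡ 1
𝟙-¬ (yes _) = refl
𝟙-¬ (no _)  = refl

𝟙-cong : (P? : Dec P) (Q? : Dec Q) → (P → Q) → (Q → P) → 𝟙 P? ≡ 𝟙 Q?
𝟙-cong (yes p) Q? P→Q Q→P = sym (𝟙-yes Q? (P→Q p))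
𝟙-cong (no ¬p) Q? P→Q Q→P = sym (𝟙-no Q? (¬p ∘ Q→P))

𝟙-mono : (P? : Dec P) (Q? : Dec Q) → (P → Q) → 𝟙 P? ≤ 𝟙 Q?
𝟙-mono (yes p) Q? P→Q = ≤-reflexive (sym (𝟙-yes Q? (P→Q p)))
𝟙-mono (no _)  Q? P→Q = z≤n

𝟙*-mono : ∀ (P? : Dec P) {a b} → (P → a ≤ b) → 𝟙 P? * a ≤ 𝟙 P? * b
𝟙*-mono (yes p) a≤b = *-monoʳ-≤ 1 (a≤b p)
𝟙*-mono (no _)  a≤b = z≤n

𝟙*-cong : ∀ (P? : Dec P) {a b} → (P → a ≡ b) → 𝟙 P? * a ≡ 𝟙 P? * b
𝟙*-cong (yes p) a≡b = cong (1 *_) (a≡b p)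
𝟙*-cong (no _)  a≡b = refl

𝟙*-cancel : ∀ (P? : Dec P) {a b} → P → 𝟙 P? * a ≡ 𝟙 P? * b → a ≡ b
𝟙*-cancel (yes _) p eq = *-cancelˡ-≡ _ _ 1 eq
𝟙*-cancel (no ¬p) p eq = contradiction p ¬p

module _ {P : A → Set} (P? : Unary.Decidable P) where

  length-filter≡∑ : ∀ xs → length (filter P? xs) ≡ (∑[ x ∈ xs ] 𝟙 (P? x))
  length-filter≡∑ []       = refl
  length-filter≡∑ (x ∷ xs) with does (P? x)
  ... | true  = cong suc (length-filter≡∑ xs)
  ... | false = length-filter≡∑ xs

  ∑𝟙-none : ∀ {xs} → (∀ {x} → x List.∈ xs → ¬ P x) → (∑[ x ∈ xs ] 𝟙 (P? x)) ≡ 0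
  ∑𝟙-none {xs} ¬P = trans (∑-cong {xs = xs} (λ x∈xs → 𝟙-no (P? _) (¬P x∈xs)))
    (trans (∑-const 0 xs) (*-zeroʳ (length xs)))

  ∑𝟙-some : ∀ {xs x} → x List.∈ xs → P x → 1 ≤ (∑[ x ∈ xs ] 𝟙 (P? x))
  ∑𝟙-some {x ∷ _} (here refl) px rewrite 𝟙-yes (P? x) px = s≤s z≤n
  ∑𝟙-some {x ∷ _} (there x∈xs) px = ≤-trans (∑𝟙-some x∈xs px) (m≤n+m _ (𝟙 (P? x)))

  ∑𝟙-two : ∀ {xs x y} → x List.∈ xs → y List.∈ xs → x ≢ y → P x → P y →
           2 ≤ (∑[ x ∈ xs ] 𝟙 (P? x))
  ∑𝟙-two (here refl) (here refl) x≢y px py = contradiction refl x≢y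
  ∑𝟙-two {x ∷ _} (here refl) (there y∈xs) x≢y px py rewrite 𝟙-yes (P? x) px =
    s≤s (∑𝟙-some y∈xs py)
  ∑𝟙-two {y ∷ _} (there x∈xs) (here refl) x≢y px py rewrite 𝟙-yes (P? y) py =
    s≤s (∑𝟙-some x∈xs px)
  ∑𝟙-two {z ∷ _} (there x∈xs) (there y∈xs) x≢y px py =
    ≤-trans (∑𝟙-two x∈xs y∈xs x≢y px py) (m≤n+m _ (𝟙 (P? z)))

  ∑𝟙-any : ∀ {xs} → 1 ≤ (∑[ x ∈ xs ] 𝟙 (P? x)) → Any P xs
  ∑𝟙-any {xs} 1≤ with Any.any? P? xs
  ... | yes p = p
  ... | no ¬p = contradiction (∑𝟙-none (λ x∈xs px → ¬p (lose x∈xs px))) (>⇒≢ 1≤)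

  ∑𝟙≤1 : ∀ {xs} → Unique xs →
         (∀ {x y} → x List.∈ xs → y List.∈ xs → x ≢ y → P x → ¬ P y) →
         (∑[ x ∈ xs ] 𝟙 (P? x)) ≤ 1
  ∑𝟙≤1 {[]}     _              _    = z≤n
  ∑𝟙≤1 {x ∷ xs} (x∉xs ∷ uniq) excl with P? x
  ... | no _   = ∑𝟙≤1 uniq (λ p q → excl (there p) (there q))
  ... | yes px = ≤-reflexive (cong suc
    (∑𝟙-none (λ y∈xs → excl (here refl) (there y∈xs) (All.lookup x∉xs y∈xs) px)))

module _ (_≟_ : DecidableEquality A) where

  ∑-δ : ∀ {xs x} → Unique xs → x List.∈ xs → ∀ c → (∑[ y ∈ xs ] 𝟙 (y ≟ x) * c) ≡ c
  ∑-δ {xs} {x} uniq x∈xs c = trans (∑-*ʳ c xs) (trans (cong (_* c) one) (*-identityˡ c))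
    where
    one : (∑[ y ∈ xs ] 𝟙 (y ≟ x)) ≡ 1
    one = ≤-antisym
      (∑𝟙≤1 (_≟ x) uniq (λ _ _ y≢z y≡x z≡x → y≢z (trans y≡x (sym z≡x))))
      (∑𝟙-some (_≟ x) x∈xs refl)

-- Positions in lists and the pigeonhole principle

lookup-injective : ∀ {xs : List A} → Unique xs → ∀ i j → lookup xs i ≡ lookup xs j → i ≡ j
lookup-injective (_ ∷ _)    Fin.zero    Fin.zero    eq = refl
lookup-injective (x∉xs ∷ _) Fin.zero    (Fin.suc j) eq =
  contradiction eq (All.lookup x∉xs (∈-lookup j))
lookup-injective (x∉xs ∷ _) (Fin.suc i) Fin.zero    eq =
  contradiction (sym eq) (All.lookup x∉xs (∈-lookup i))
lookup-injective (_ ∷ uniq) (Fin.suc i) (Fin.suc j) eq =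
  cong Fin.suc (lookup-injective uniq i j eq)

-- In a shorter list, two different values would have to occupy the same position.
covers⇒m≤length : ∀ {m} {xs : List (Fin m)} → (∀ i → i List.∈ xs) → m ≤ length xs
covers⇒m≤length {m} {xs} covers = ≮⇒≥ λ ∣xs∣<m →
  let i , j , i<j , eq = Fin.pigeonhole ∣xs∣<m (index ∘ covers)
  in Fin.<⇒≢ i<j (trans (lookup-index (covers i))
       (trans (cong (lookup xs) eq) (sym (lookup-index (covers j)))))

∃-fresh : ∀ {m} (xs : List (Fin m)) → length xs < m → ∃ λ i → ¬ (i List.∈ xs)
∃-fresh {m} xs ∣xs∣<m = Fin.¬∀⟶∃¬ m (List._∈ xs) (_∈ᶠ? xs)
  (λ covers → <⇒≱ ∣xs∣<m (covers⇒m≤length covers))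
  where open DecMembership Fin._≟_ renaming (_∈?_ to _∈ᶠ?_)

-- Subsets, degrees and codegrees

private
  variable
    n : ℕ

infix 4 _≟ˢ_
_≟ˢ_ : DecidableEquality (Subset n)
_≟ˢ_ = Vec.≡-dec _≟ᵇ_

-- Separates the contribution `c` of the point `v` itself from that of the points around it.
∑-δ-+ : ∀ (v : Fin n) c (f : Fin n → ℕ) →
        (∑[ u ∈ allFin n ] 𝟙 (u Fin.≟ v) * c + f u) ≡ c + ∑ (allFin n) f
∑-δ-+ {n} v c f = trans (∑-+ (allFin n))
  (cong (_+ ∑ (allFin n) f) (∑-δ Fin._≟_ (Unique.allFin⁺ n) (∈-allFin v) c))

∣e∣≡∑ : (e : Subset n) → ∣ e ∣ ≡ (∑[ v ∈ allFin n ] 𝟙 (v ∈? e))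
∣e∣≡∑ e = trans (tabulated e) (sym (cong sum (map-tabulate (λ v → v) (λ v → 𝟙 (v ∈? e)))))
  where
  tabulated : ∀ {n} (e : Subset n) → ∣ e ∣ ≡ sum (tabulate (λ v → 𝟙 (v ∈? e)))
  tabulated []            = refl
  tabulated (inside  ∷ e) = cong suc (tabulated e)
  tabulated (outside ∷ e) = tabulated e

∣e∩f∣≡∑ : (e f : Subset n) →
          ∣ e ∩ f ∣ ≡ (∑[ v ∈ allFin n ] 𝟙 (v ∈? e) * 𝟙 (v ∈? f))
∣e∩f∣≡∑ {n} e f = trans (∣e∣≡∑ (e ∩ f)) (∑-cong {xs = allFin n} λ {v} _ →
  trans (𝟙-cong (v ∈? e ∩ f) (v ∈? e ×-dec v ∈? f) (x∈p∩q⁻ e f) x∈p∩q⁺)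
        (𝟙-× (v ∈? e) (v ∈? f)))

∣e∩f∣≤1⇒no-second : ∀ (e f : Subset n) {u v} → ∣ e ∩ f ∣ ≤ 1 → u ≢ v →
                 u ∈ e → u ∈ f → v ∈ e → ¬ v ∈ f
∣e∩f∣≤1⇒no-second e f ∣e∩f∣≤1 u≢v u∈e u∈f v∈e v∈f =
  <⇒≱ (∑𝟙-two (_∈? e ∩ f) (∈-allFin _) (∈-allFin _) u≢v
        (x∈p∩q⁺ (u∈e , u∈f)) (x∈p∩q⁺ (v∈e , v∈f)))
      (subst (_≤ 1) (∣e∣≡∑ (e ∩ f)) ∣e∩f∣≤1)

deg : List (Subset n) → Fin n → ℕ
deg F v = ∑[ e ∈ F ] 𝟙 (v ∈? e)

codeg : List (Subset n) → Fin n → Fin n → ℕ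
codeg F u v = ∑[ e ∈ F ] 𝟙 (u ∈? e) * 𝟙 (v ∈? e)

Covered : List (Subset n) → Fin n → Set
Covered F v = Any (v ∈_) F

covered? : (F : List (Subset n)) → Unary.Decidable (Covered F)
covered? F v = Any.any? (v ∈?_) F

order : List (Subset n) → ℕ
order {n} F = ∑[ v ∈ allFin n ] 𝟙 (covered? F v)

-- Adjacency in the 2-section, for a bare list of hyperedges. The form agrees definitionally with
-- the one in `[_]₂`, so counts of collinear points are vertex degrees there.
Collinear : List (Subset n) → Fin n → Fin n → Set
Collinear F u v = u ≢ v × Any (λ e → u ∈ e × v ∈ e) F

collinear? : (F : List (Subset n)) (u v : Fin n) → Dec (Collinear F u v)
collinear? F u v = ¬? (u Fin.≟ v) ×-dec Any.any? (λ e → u ∈? e ×-dec v ∈? e) F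

codeg-diag : (F : List (Subset n)) (v : Fin n) → codeg F v v ≡ deg F v
codeg-diag F v = ∑-cong {xs = F} λ {e} _ → idem (v ∈? e)
  where
  idem : (P? : Dec P) → 𝟙 P? * 𝟙 P? ≡ 𝟙 P?
  idem (yes _) = refl
  idem (no _)  = refl

∑-weighted-deg : (F : List (Subset n)) (w : Fin n → ℕ) →
  (∑[ v ∈ allFin n ] w v * deg F v) ≡ (∑[ e ∈ F ] ∑[ v ∈ allFin n ] w v * 𝟙 (v ∈? e))
∑-weighted-deg {n} F w = trans
  (∑-cong {xs = allFin n} (λ {v} _ → sym (∑-*ˡ (w v) F)))
  (∑-swap (λ v e → w v * 𝟙 (v ∈? e)) (allFin n) F)

-- Counting around a point of a uniform linear hypergraph

record IsLinearSpace {n} (l : ℕ) (F : List (Subset n)) : Set where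
  field
    unique  : Unique F
    uniform : ∀ {e} → e List.∈ F → ∣ e ∣ ≡ suc l
    linear  : ∀ {e f} → e List.∈ F → f List.∈ F → e ≢ f → ∣ e ∩ f ∣ ≤ 1

  ∑𝟙-edge : ∀ {e} → e List.∈ F → (∑[ v ∈ allFin n ] 𝟙 (v ∈? e)) ≡ suc l
  ∑𝟙-edge {e} e∈F = trans (sym (∣e∣≡∑ e)) (uniform e∈F)

  ∑-codeg : ∀ v → (∑[ u ∈ allFin n ] codeg F v u) ≡ deg F v * suc l
  ∑-codeg v = trans (∑-swap (λ u e → 𝟙 (v ∈? e) * 𝟙 (u ∈? e)) (allFin n) F)
    (trans (∑-cong {xs = F} λ {e} e∈F →
              trans (∑-*ˡ (𝟙 (v ∈? e)) (allFin n)) (cong (𝟙 (v ∈? e) *_) (∑𝟙-edge e∈F)))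
           (∑-*ʳ (suc l) F))

  ∑-deg : (∑[ v ∈ allFin n ] deg F v) ≡ length F * suc l
  ∑-deg = trans (∑-swap (λ v e → 𝟙 (v ∈? e)) (allFin n) F)
    (trans (∑-cong {xs = F} ∑𝟙-edge) (∑-const (suc l) F))

  -- By linearity at most one hyperedge contains two given points, and none does if `Q` fails.
  -- Keeping `Q` open lets one bound serve both collinearity and coveredness.
  codeg≤ : ∀ {u v} → u ≢ v → (Q? : Dec Q) →
           (∀ {e} → e List.∈ F → u ∈ e → v ∈ e → Q) → codeg F u v ≤ 𝟙 Q?
  codeg≤ {u = u} {v} u≢v Q? ⇒Q = ≤-trans
    (≤-reflexive (∑-cong {xs = F} λ {e} _ → sym (𝟙-× (u ∈? e) (v ∈? e))))
    (bound Q?)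
    where
    through? : ∀ e → Dec (u ∈ e × v ∈ e)
    through? e = u ∈? e ×-dec v ∈? e

    bound : (Q? : Dec _) → (∑[ e ∈ F ] 𝟙 (through? e)) ≤ 𝟙 Q?
    bound (yes _) = ∑𝟙≤1 through? unique λ {e} {f} e∈F f∈F e≢f (u∈e , v∈e) (u∈f , v∈f) →
      ∣e∩f∣≤1⇒no-second e f (linear e∈F f∈F e≢f) u≢v u∈e u∈f v∈e v∈f
    bound (no ¬q) = ≤-reflexive
      (∑𝟙-none through? λ e∈F (u∈e , v∈e) → ¬q (⇒Q e∈F u∈e v∈e))

  -- Count pairs of a hyperedge through `v` and a point on it: there are `deg F v * suc l`. The
  -- point `v` accounts for `deg F v` of them, and any other point for at most one, and only if it
  -- is collinear with `v`.
  deg*l≤collinear : ∀ v → deg F v * l ≤ (∑[ u ∈ allFin n ] 𝟙 (collinear? F v u))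
  deg*l≤collinear v = +-cancelˡ-≤ (deg F v) _ _ (begin
    deg F v + deg F v * l            ≡⟨ *-suc (deg F v) l ⟨
    deg F v * suc l                  ≡⟨ ∑-codeg v ⟨
    (∑[ u ∈ allFin n ] codeg F v u)  ≤⟨ ∑-mono {xs = allFin n} (λ {u} _ → pointwise u) ⟩
    (∑[ u ∈ allFin n ] 𝟙 (u Fin.≟ v) * deg F v + 𝟙 (collinear? F v u))
      ≡⟨ ∑-δ-+ v (deg F v) (λ u → 𝟙 (collinear? F v u)) ⟩
    deg F v + (∑[ u ∈ allFin n ] 𝟙 (collinear? F v u))  ∎)
    where
    open ≤-Reasoning
    pointwise : ∀ u → codeg F v u ≤ 𝟙 (u Fin.≟ v) * deg F v + 𝟙 (collinear? F v u)
    -- The explicit motive abstracts the decision only inside the leading indicator, which then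
    -- computes in each branch.
    pointwise u = case u Fin.≟ v returning (λ d → codeg F v u ≤ 𝟙 d * deg F v + 𝟙 (collinear? F v u)) of λ where
      (yes refl) → ≤-trans (≤-reflexive (trans (codeg-diag F v) (sym (+-identityʳ _))))
                           (m≤m+n _ _)
      (no u≢v)   → codeg≤ (≢-sym u≢v) (collinear? F v u) λ e∈F v∈e u∈e →
                     ≢-sym u≢v , lose e∈F (v∈e , u∈e)

  -- The point `v` and the points collinear with it are all covered, and no point is counted twice
  -- because `v` is not collinear with itself.
  δ+collinear≤covered : ∀ v → Covered F v → ∀ {u} →
    𝟙 (u Fin.≟ v) * 1 + 𝟙 (collinear? F v u) ≤ 𝟙 (covered? F u)
  δ+collinear≤covered v v∈F {u} with u Fin.≟ v
  ... | yes refl = ≤-reflexive (trans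
    (cong suc (𝟙-no (collinear? F v v) (λ (v≢v , _) → v≢v refl)))
    (sym (𝟙-yes (covered? F v) v∈F)))
  ... | no _     = 𝟙-mono (collinear? F v u) (covered? F u) (Any.map proj₂ ∘ proj₂)

  1+deg*l≤δ+collinear : ∀ v → suc (deg F v * l) ≤
    (∑[ u ∈ allFin n ] 𝟙 (u Fin.≟ v) * 1 + 𝟙 (collinear? F v u))
  1+deg*l≤δ+collinear v = ≤-trans (s≤s (deg*l≤collinear v)) (≤-reflexive (sym
    (∑-δ-+ v 1 (λ u → 𝟙 (collinear? F v u)))))

  deg*l<order : ∀ {v} → Covered F v → deg F v * l < order F
  deg*l<order {v} v∈F = ≤-trans (1+deg*l≤δ+collinear v)
    (∑-mono {xs = allFin n} (λ _ → δ+collinear≤covered v v∈F))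

  -- The equality case of `deg*l<order`: no covered point is left over, so each one other than `v`
  -- shares a hyperedge with `v`.
  tight⇒collinear : ∀ {v} → Covered F v → order F ≤ suc (deg F v * l) →
                    ∀ {u} → Covered F u → v ≢ u → codeg F v u ≡ 1
  tight⇒collinear {v} v∈F tight {u} u∈F v≢u = ≤-antisym
    (codeg≤ v≢u (yes u∈F) (λ _ _ _ → u∈F))
    (let e , e∈F , v∈e,u∈e = find (proj₂ v~u) in
     ≤-trans (∑𝟙-some (λ e → v ∈? e ×-dec u ∈? e) e∈F v∈e,u∈e)
             (≤-reflexive (∑-cong {xs = F} λ {e} _ → 𝟙-× (v ∈? e) (u ∈? e))))
    where
    eq : 𝟙 (u Fin.≟ v) * 1 + 𝟙 (collinear? F v u) ≡ 𝟙 (covered? F u)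
    eq = ∑-tight {xs = allFin n} (λ _ → δ+collinear≤covered v v∈F)
      (≤-trans tight (1+deg*l≤δ+collinear v)) (∈-allFin u)

    v~u : Collinear F v u
    v~u = 𝟙-holds (collinear? F v u) (trans
      (cong (λ a → a * 1 + 𝟙 (collinear? F v u)) (sym (𝟙-no (u Fin.≟ v) (≢-sym v≢u))))
      (trans eq (𝟙-yes (covered? F u) u∈F)))

  filter-isLinearSpace : ∀ {P : Subset n → Set} (P? : Unary.Decidable P) →
                         IsLinearSpace l (filter P? F)
  filter-isLinearSpace P? = record
    { unique  = Unique.filter⁺ P? unique
    ; uniform = uniform ∘ member
    ; linear  = λ e∈ f∈ → linear (member e∈) (member f∈)
    }
    where
    member : ∀ {e} → e List.∈ filter P? F → e List.∈ F
    member = proj₁ ∘ ∈-filter⁻ P?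

nonempty⇒1≤∣e∣ : {e : Subset n} → Nonempty e → 1 ≤ ∣ e ∣
nonempty⇒1≤∣e∣ {e = e} (v , v∈e) =
  ≤-trans (∑𝟙-some (_∈? e) {xs = allFin _} (∈-allFin v) v∈e) (≤-reflexive (sym (∣e∣≡∑ e)))

𝟙-nonempty : {e : Subset n} → ∣ e ∣ ≤ 1 → 𝟙 (nonempty? e) ≡ ∣ e ∣
𝟙-nonempty {e = e} ∣e∣≤1 with nonempty? e
... | yes ne  = ≤-antisym (nonempty⇒1≤∣e∣ ne) ∣e∣≤1
... | no ¬ne  = sym (trans (∣e∣≡∑ e) (∑𝟙-none (_∈? e) {xs = allFin _} λ {v} _ v∈e → ¬ne (v , v∈e)))

-- Neighbouring hyperedges and greedy colouring

Neighbour : Subset n → Subset n → Set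
Neighbour e f = f ≢ e × Nonempty (e ∩ f)

neighbour? : (e : Subset n) → Unary.Decidable (Neighbour e)
neighbour? e f = ¬? (f ≟ˢ e) ×-dec nonempty? (e ∩ f)

neighbours : List (Subset n) → Subset n → List (Subset n)
neighbours F e = filter (neighbour? e) F

-- Double counting turns the degree sum over `e` into the sum of `∣ e ∩ f ∣` over all `f`. There `e`
-- itself contributes `suc l` and each neighbour at least 1.
neighbours≤∑deg : ∀ {l} {F : List (Subset n)} → IsLinearSpace l F → ∀ {e} → e List.∈ F →
  length (neighbours F e) + suc l ≤ (∑[ v ∈ allFin n ] 𝟙 (v ∈? e) * deg F v)
neighbours≤∑deg {n} {l} {F} S {e} e∈F = begin
  length (neighbours F e) + suc l
    ≡⟨ cong₂ _+_ (length-filter≡∑ (neighbour? e) F) (sym (∑-δ _≟ˢ_ unique e∈F (suc l))) ⟩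
  (∑[ f ∈ F ] 𝟙 (neighbour? e f)) + (∑[ f ∈ F ] 𝟙 (f ≟ˢ e) * suc l)
    ≡⟨ ∑-+ F ⟨
  (∑[ f ∈ F ] 𝟙 (neighbour? e f) + 𝟙 (f ≟ˢ e) * suc l)
    ≤⟨ ∑-mono {xs = F} (λ {f} _ → pointwise f) ⟩
  (∑[ f ∈ F ] ∣ e ∩ f ∣)
    ≡⟨ ∑-cong {xs = F} (λ {f} _ → ∣e∩f∣≡∑ e f) ⟩
  (∑[ f ∈ F ] ∑[ v ∈ allFin n ] 𝟙 (v ∈? e) * 𝟙 (v ∈? f))
    ≡⟨ ∑-weighted-deg F (λ v → 𝟙 (v ∈? e)) ⟨
  (∑[ v ∈ allFin n ] 𝟙 (v ∈? e) * deg F v) ∎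
  where
  open IsLinearSpace S
  open ≤-Reasoning
  pointwise : ∀ f → 𝟙 (neighbour? e f) + 𝟙 (f ≟ˢ e) * suc l ≤ ∣ e ∩ f ∣
  pointwise f with f ≟ˢ e
  ... | yes refl = ≤-reflexive (trans (+-identityʳ (suc l))
    (sym (trans (cong ∣_∣ (∩-idem e)) (uniform e∈F))))
  ... | no f≢e with nonempty? (e ∩ f)
  ...   | yes ne = nonempty⇒1≤∣e∣ ne
  ...   | no _   = z≤n

ProperOn : List (Subset n) → {m : ℕ} → (Subset n → Fin m) → Set
ProperOn F c = ∀ {e f} → e List.∈ F → f List.∈ F → e ≢ f → Nonempty (e ∩ f) → c e ≢ c f

_without_ : List (Subset n) → Subset n → List (Subset n)
F without e = filter (λ f → ¬? (f ≟ˢ e)) F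

-- The neighbours of `e` use fewer than `m` colours, so one remains free for `e`.
greedy : ∀ {m} {F : List (Subset n)} {e} → length (neighbours F e) < m →
         (∃ λ (c : Subset n → Fin m) → ProperOn (F without e) c) →
         ∃ λ (c : Subset n → Fin m) → ProperOn F c
greedy {n} {m} {F} {e} few (c , proper) = c′ , proper′
  where
  fresh : ∃ λ i → ¬ (i List.∈ map c (neighbours F e))
  fresh = ∃-fresh (map c (neighbours F e))
    (subst (_< m) (sym (length-map c (neighbours F e))) few)

  new : Fin m
  new = proj₁ fresh

  c′ : Subset n → Fin m
  c′ f with f ≟ˢ e
  ... | yes _ = new
  ... | no _  = c f

  new≢ : ∀ {f} → f List.∈ F → f ≢ e → Nonempty (e ∩ f) → new ≢ c f
  new≢ f∈F f≢e ne eq = proj₂ fresh (subst (List._∈ _) (sym eq)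
    (∈-map⁺ c (∈-filter⁺ (neighbour? e) f∈F (f≢e , ne))))

  proper′ : ProperOn F c′
  proper′ {f} {g} f∈F g∈F f≢g ne with f ≟ˢ e | g ≟ˢ e
  ... | yes refl | yes refl = contradiction refl f≢g
  ... | yes refl | no g≢e   = new≢ g∈F g≢e ne
  ... | no f≢e   | yes refl =
    ≢-sym (new≢ f∈F f≢e (subst Nonempty (∩-comm f e) ne))
  ... | no f≢e   | no g≢e   =
    proper (∈-filter⁺ _ f∈F f≢e) (∈-filter⁺ _ g∈F g≢e) f≢g ne

-- The affine plane and its parallel classes

module AffinePlane {l} {F : List (Subset n)} (S : IsLinearSpace l F)
  (regular : ∀ {v} → Covered F v → deg F v ≡ 2 + l)
  (order≡  : order F ≡ suc l * suc l)
  where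

  open IsLinearSpace S

  -- Since `(l + 1)² = 1 + (l + 2) l`, the bound `deg*l<order` is tight at every covered point.
  codeg≡1 : ∀ {u v} → Covered F u → Covered F v → u ≢ v → codeg F u v ≡ 1
  codeg≡1 {u} u∈F = tight⇒collinear u∈F (≤-reflexive (trans order≡
    (trans (square l) (cong (λ d → suc (d * l)) (sym (regular u∈F))))))
    where
    square : ∀ l → suc l * suc l ≡ suc ((2 + l) * l)
    square = solve-∀

  module _ {p g} (p∈F : Covered F p) (g∈F : g List.∈ F) (p∉g : ¬ p ∈ g) where

    open ≡-Reasoning

    -- Each point of `g` is joined to `p` by exactly one hyperedge, and different points of `g` by
    -- different ones, as a hyperedge through `p` is not `g` and so meets `g` at most once.
    ∑-meeting : (∑[ e ∈ F ] 𝟙 (p ∈? e) * 𝟙 (nonempty? (e ∩ g))) ≡ suc l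
    ∑-meeting = begin
      (∑[ e ∈ F ] 𝟙 (p ∈? e) * 𝟙 (nonempty? (e ∩ g)))
        ≡⟨ ∑-cong {xs = F} (λ {e} e∈F → 𝟙*-cong (p ∈? e) λ p∈e →
             𝟙-nonempty {e = e ∩ g} (linear e∈F g∈F λ { refl → p∉g p∈e })) ⟩
      (∑[ e ∈ F ] 𝟙 (p ∈? e) * ∣ e ∩ g ∣)
        ≡⟨ ∑-cong {xs = F} (λ {e} _ → trans
             (cong (𝟙 (p ∈? e) *_) (trans (cong ∣_∣ (∩-comm e g)) (∣e∩f∣≡∑ g e)))
             (sym (∑-*ˡ (𝟙 (p ∈? e)) (allFin n)))) ⟩
      (∑[ e ∈ F ] ∑[ u ∈ allFin n ] 𝟙 (p ∈? e) * (𝟙 (u ∈? g) * 𝟙 (u ∈? e)))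
        ≡⟨ ∑-swap (λ e u → 𝟙 (p ∈? e) * (𝟙 (u ∈? g) * 𝟙 (u ∈? e))) F (allFin n) ⟩
      (∑[ u ∈ allFin n ] ∑[ e ∈ F ] 𝟙 (p ∈? e) * (𝟙 (u ∈? g) * 𝟙 (u ∈? e)))
        ≡⟨ ∑-cong {xs = allFin n} (λ {u} _ → trans
             (∑-cong {xs = F} (λ {e} _ → rotate (𝟙 (p ∈? e)) (𝟙 (u ∈? g)) (𝟙 (u ∈? e))))
             (∑-*ˡ (𝟙 (u ∈? g)) F)) ⟩
      (∑[ u ∈ allFin n ] 𝟙 (u ∈? g) * codeg F p u)
        ≡⟨ ∑-cong {xs = allFin n} (λ {u} _ → trans
             (𝟙*-cong (u ∈? g) λ u∈g →
               codeg≡1 p∈F (lose g∈F u∈g) λ { refl → p∉g u∈g })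
             (*-identityʳ _)) ⟩
      (∑[ u ∈ allFin n ] 𝟙 (u ∈? g))
        ≡⟨ ∑𝟙-edge g∈F ⟩
      suc l ∎
      where
      rotate : ∀ a b c → a * (b * c) ≡ b * (a * c)
      rotate = solve-∀

    Parallel : Subset n → Set
    Parallel e = p ∈ e × ¬ Nonempty (e ∩ g)

    parallel? : Unary.Decidable Parallel
    parallel? e = p ∈? e ×-dec ¬? (nonempty? (e ∩ g))

    -- Playfair's axiom: of the `l + 2` hyperedges through `p`, exactly `l + 1` meet `g`.
    ∑-parallel : (∑[ e ∈ F ] 𝟙 (parallel? e)) ≡ 1
    ∑-parallel = +-cancelˡ-≡ (suc l) _ 1 (begin
      suc l + (∑[ e ∈ F ] 𝟙 (parallel? e))
        ≡⟨ cong₂ _+_ (sym ∑-meeting) (∑-cong {xs = F} λ {e} _ → 𝟙-× (p ∈? e) (¬? (nonempty? (e ∩ g)))) ⟩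
      (∑[ e ∈ F ] 𝟙 (p ∈? e) * 𝟙 (nonempty? (e ∩ g))) +
      (∑[ e ∈ F ] 𝟙 (p ∈? e) * 𝟙 (¬? (nonempty? (e ∩ g))))
        ≡⟨ ∑-+ F ⟨
      (∑[ e ∈ F ] 𝟙 (p ∈? e) * 𝟙 (nonempty? (e ∩ g)) + 𝟙 (p ∈? e) * 𝟙 (¬? (nonempty? (e ∩ g))))
        ≡⟨ ∑-cong {xs = F} (λ {e} _ → trans
             (sym (*-distribˡ-+ (𝟙 (p ∈? e)) _ _))
             (trans (cong (𝟙 (p ∈? e) *_) (𝟙-¬ (nonempty? (e ∩ g)))) (*-identityʳ _))) ⟩
      deg F p
        ≡⟨ regular p∈F ⟩
      2 + l
        ≡⟨ +-comm 1 (suc l) ⟩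
      suc l + 1 ∎)

    parallel-exists : Any Parallel F
    parallel-exists = ∑𝟙-any parallel? (≤-reflexive (sym ∑-parallel))

    parallel-unique : ∀ {e f} → e List.∈ F → f List.∈ F → Parallel e → Parallel f → ¬ (e ≢ f)
    parallel-unique e∈F f∈F e∥g f∥g e≢f =
      <⇒≱ (∑𝟙-two parallel? e∈F f∈F e≢f e∥g f∥g) (≤-reflexive ∑-parallel)

  -- The number of colours is written `suc m` so that `Fin.zero` is available as a default colour.
  module _ {p} (p∈F : Covered F p) {m} (2+l≤m : 2 + l ≤ suc m) where

    pencil : List (Subset n)
    pencil = filter (p ∈?_) F

    ∣pencil∣≤m : length pencil ≤ suc m
    ∣pencil∣≤m = ≤-trans
      (≤-reflexive (trans (length-filter≡∑ (p ∈?_) F) (regular p∈F))) 2+l≤m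

    EqualOrDisjoint : Subset n → Subset n → Set
    EqualOrDisjoint e g = g ≡ e ⊎ ¬ Nonempty (g ∩ e)

    equalOrDisjoint? : ∀ e → Unary.Decidable (EqualOrDisjoint e)
    equalOrDisjoint? e g = g ≟ˢ e ⊎-dec ¬? (nonempty? (g ∩ e))

    pencil-represents : ∀ {e} → e List.∈ F → Any (EqualOrDisjoint e) pencil
    pencil-represents {e} e∈F with p ∈? e
    ... | yes p∈e = lose (∈-filter⁺ (p ∈?_) e∈F p∈e) (inj₁ refl)
    ... | no p∉e  =
      let g , g∈F , p∈g , g∥e = find (parallel-exists p∈F e∈F p∉e)
      in lose (∈-filter⁺ (p ∈?_) g∈F p∈g) (inj₂ g∥e)

    -- A parallel class is named by the position of its member through `p`. The default is never
    -- taken on members of `F`, by `pencil-represents`.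
    class : Subset n → Fin (suc m)
    class e with Any.any? (equalOrDisjoint? e) pencil
    ... | yes i = inject≤ (index i) ∣pencil∣≤m
    ... | no _  = Fin.zero

    class-representative : ∀ {e} → e List.∈ F → ∃ λ i →
      class e ≡ inject≤ i ∣pencil∣≤m × EqualOrDisjoint e (lookup pencil i)
    class-representative {e} e∈F with Any.any? (equalOrDisjoint? e) pencil
    ... | yes i = index i , refl , lookup-index i
    ... | no ¬i = contradiction (pencil-represents e∈F) ¬i

    class-proper : ProperOn F class
    class-proper {e} {f} e∈F f∈F e≢f (q , q∈e∩f) eq
      with i , ce , rᵉ ← class-representative e∈F
         | j , cf , rᶠ ← class-representative f∈F
      with refl ← Fin.inject≤-injective ∣pencil∣≤m ∣pencil∣≤m i j (trans (sym ce) (trans eq cf))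
      = clash g∈F rᵉ rᶠ
      where
      q∈e : q ∈ e
      q∈e = proj₁ (x∈p∩q⁻ e f q∈e∩f)

      q∈f : q ∈ f
      q∈f = proj₂ (x∈p∩q⁻ e f q∈e∩f)

      g∈F : lookup pencil i List.∈ F
      g∈F = proj₁ (∈-filter⁻ (p ∈?_) (∈-lookup i))

      clash : ∀ {g} → g List.∈ F → EqualOrDisjoint e g → EqualOrDisjoint f g → ⊥
      clash g∈F (inj₁ refl) (inj₁ refl) = e≢f refl
      clash g∈F (inj₁ refl) (inj₂ e∥f)  = e∥f (q , x∈p∩q⁺ (q∈e , q∈f))
      clash g∈F (inj₂ f∥e)  (inj₁ refl) = f∥e (q , x∈p∩q⁺ (q∈f , q∈e))
      -- Here `q` lies off `g`, because `g` misses `e`; so `e` and `f` would be two parallels to `g`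
      -- through `q`.
      clash {g} g∈F (inj₂ g∥e) (inj₂ g∥f) =
        parallel-unique (lose e∈F q∈e) g∈F (λ q∈g → g∥e (q , x∈p∩q⁺ (q∈g , q∈e))) e∈F f∈F
          (q∈e , subst (λ x → ¬ Nonempty x) (∩-comm g e) g∥e)
          (q∈f , subst (λ x → ¬ Nonempty x) (∩-comm g f) g∥f)
          e≢f

-- When every hyperedge has more than `D` neighbours

module Stuck {l D} {F : List (Subset n)} (S : IsLinearSpace l F)
  (n≤       : n ≤ l * l + 3 * l)
  (deg*l≤D  : ∀ v → deg F v * l ≤ D)
  (crowded  : ∀ {e} → e List.∈ F → D < length (neighbours F e))
  where

  open IsLinearSpace S
  open ≤-Reasoning

  order≤ : order F ≤ l * l + 3 * l
  order≤ = begin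
    order F                  ≤⟨ ∑-mono {xs = allFin n} (λ {v} _ → 𝟙≤1 (covered? F v)) ⟩
    (∑[ _ ∈ allFin n ] 1)    ≡⟨ ∑-const 1 (allFin n) ⟩
    length (allFin n) * 1    ≡⟨ *-identityʳ _ ⟩
    length (allFin n)        ≡⟨ length-tabulate {n = n} (λ v → v) ⟩
    n                        ≤⟨ n≤ ⟩
    l * l + 3 * l            ∎
    where
    𝟙≤1 : (P? : Dec P) → 𝟙 P? ≤ 1
    𝟙≤1 (yes _) = ≤-refl
    𝟙≤1 (no _)  = z≤n

  -- Degree `l + 3` or more would already give `l * l + 3 * l` points besides `v`.
  deg≤ : ∀ {v} → Covered F v → deg F v ≤ 2 + l
  deg≤ {v} v∈F = ≮⇒≥ λ 2+l<deg → <-irrefl refl (begin-strict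
    deg F v * l        <⟨ deg*l<order v∈F ⟩
    order F            ≤⟨ order≤ ⟩
    l * l + 3 * l      ≡⟨ +-comm (l * l) (3 * l) ⟩
    3 * l + l * l      ≡⟨ *-distribʳ-+ l 3 l ⟨
    (3 + l) * l        ≤⟨ *-monoˡ-≤ l 2+l<deg ⟩
    deg F v * l        ∎)

  edge-deg : Subset n → ℕ
  edge-deg e = ∑[ v ∈ allFin n ] 𝟙 (v ∈? e) * deg F v

  edge-deg> : ∀ {e} → e List.∈ F → suc D + suc l ≤ edge-deg e
  edge-deg> e∈F = ≤-trans (+-monoˡ-≤ (suc l) (crowded e∈F)) (neighbours≤∑deg S e∈F)

  -- Multiply `edge-deg>` by `l` and bound each of the `l + 1` terms `deg F v * l` by `D`: then
  -- `(D + l + 2) l ≤ (l + 1) D`, and `D * l` cancels.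
  D≥ : ∀ {e} → e List.∈ F → l * (2 + l) ≤ D
  D≥ {e} e∈F = +-cancelʳ-≤ (D * l) _ _ (begin
    l * (2 + l) + D * l         ≡⟨ shape l D ⟩
    (suc D + suc l) * l         ≤⟨ *-monoˡ-≤ l (edge-deg> e∈F) ⟩
    edge-deg e * l              ≡⟨ ∑-*ʳ l (allFin n) ⟨
    (∑[ v ∈ allFin n ] 𝟙 (v ∈? e) * deg F v * l)
      ≤⟨ ∑-mono {xs = allFin n} (λ {v} _ → ≤-trans
           (≤-reflexive (*-assoc (𝟙 (v ∈? e)) (deg F v) l))
           (*-monoʳ-≤ (𝟙 (v ∈? e)) (deg*l≤D v))) ⟩
    (∑[ v ∈ allFin n ] 𝟙 (v ∈? e) * D)
      ≡⟨ ∑-*ʳ D (allFin n) ⟩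
    (∑[ v ∈ allFin n ] 𝟙 (v ∈? e)) * D
      ≡⟨ cong (_* D) (∑𝟙-edge e∈F) ⟩
    D + l * D                   ≡⟨ cong (D +_) (*-comm l D) ⟩
    D + D * l                   ∎)
    where
    shape : ∀ l D → l * (2 + l) + D * l ≡ (suc D + suc l) * l
    shape = solve-∀

  -- On a hyperedge through `v`, the degrees are at most `l + 2` each but sum to at least
  -- `(l + 1) (l + 2)`, by `D≥` and `edge-deg>`.
  regular : ∀ {v} → Covered F v → deg F v ≡ 2 + l
  regular {v} v∈F = 𝟙*-cancel (v ∈? e) v∈e (∑-tight {xs = allFin n}
    (λ {u} _ → 𝟙*-mono (u ∈? e) λ u∈e → deg≤ (lose e∈F u∈e))
    (begin
      (∑[ u ∈ allFin n ] 𝟙 (u ∈? e) * (2 + l))  ≡⟨ ∑-*ʳ (2 + l) (allFin n) ⟩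
      (∑[ u ∈ allFin n ] 𝟙 (u ∈? e)) * (2 + l)  ≡⟨ cong (_* (2 + l)) (∑𝟙-edge e∈F) ⟩
      suc l * (2 + l)                           ≡⟨ shape l ⟩
      suc (l * (2 + l)) + suc l                 ≤⟨ +-monoˡ-≤ (suc l) (s≤s (D≥ e∈F)) ⟩
      suc D + suc l                             ≤⟨ edge-deg> e∈F ⟩
      edge-deg e                                ∎)
    (∈-allFin v))
    where
    e : Subset n
    e = proj₁ (find v∈F)

    e∈F : e List.∈ F
    e∈F = proj₁ (proj₂ (find v∈F))

    v∈e : v ∈ e
    v∈e = proj₂ (proj₂ (find v∈F))

    shape : ∀ l → suc l * (2 + l) ≡ suc (l * (2 + l)) + suc l
    shape = solve-∀

  -- Counts incidences in two ways; uncovered points have degree 0.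
  order*[2+l]≡ : order F * (2 + l) ≡ length F * suc l
  order*[2+l]≡ = trans (sym (∑-*ʳ (2 + l) (allFin n)))
    (trans (∑-cong {xs = allFin n} (λ {v} _ → pointwise v)) ∑-deg)
    where
    pointwise : ∀ v → 𝟙 (covered? F v) * (2 + l) ≡ deg F v
    pointwise v = case covered? F v returning (λ d → 𝟙 d * (2 + l) ≡ deg F v) of λ where
      (yes v∈F) → trans (*-identityˡ (2 + l)) (sym (regular v∈F))
      (no v∉F)  → sym (∑𝟙-none (v ∈?_) λ e∈F v∈e → v∉F (lose e∈F v∈e))

  order≡ : ∀ {v} → Covered F v → order F ≡ suc l * suc l
  order≡ {v} v∈F = trans (sym excess)
    (trans (cong (suc l * suc l +_) (r≡0 _ excess)) (+-identityʳ _))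
    where
    square≤order : suc l * suc l ≤ order F
    square≤order = begin
      suc l * suc l         ≡⟨ square l ⟩
      suc ((2 + l) * l)     ≡⟨ cong (λ d → suc (d * l)) (regular v∈F) ⟨
      suc (deg F v * l)     ≤⟨ deg*l<order v∈F ⟩
      order F               ∎
      where
      square : ∀ l → suc l * suc l ≡ suc ((2 + l) * l)
      square = solve-∀

    excess : suc l * suc l + (order F ∸ suc l * suc l) ≡ order F
    excess = m+[n∸m]≡n square≤order

    -- The bound on the order even gives `r < l`; the weaker form is what divisibility by `suc l`
    -- calls for.
    r<1+l : ∀ r → suc l * suc l + r ≡ order F → r < suc l
    r<1+l r eq = m<n⇒m<1+n (+-cancelˡ-≤ (l * l + 2 * l) _ _ (begin
      l * l + 2 * l + suc r    ≡⟨ left l r ⟩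
      suc l * suc l + r        ≡⟨ eq ⟩
      order F                  ≤⟨ order≤ ⟩
      l * l + 3 * l            ≡⟨ right l ⟩
      l * l + 2 * l + l        ∎))
      where
      left : ∀ l r → l * l + 2 * l + suc r ≡ suc l * suc l + r
      left = solve-∀
      right : ∀ l → l * l + 3 * l ≡ l * l + 2 * l + l
      right = solve-∀

    -- Modulo `l + 1` the factor `l + 2` is 1 and the square vanishes, so the product in
    -- `order*[2+l]≡` reduces to `r`, while its other side is a multiple of `l + 1`.
    1+l∣r : ∀ r → suc l * suc l + r ≡ order F → suc l ∣ r
    1+l∣r r eq = ∣m+n∣m⇒∣n {m = suc l * (suc l * (2 + l) + r)}
      (divides (length F) (trans (expand l r) (trans (cong (_* (2 + l)) eq) order*[2+l]≡)))
      (m∣m*n _)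
      where
      expand : ∀ l r → suc l * (suc l * (2 + l) + r) + r ≡ (suc l * suc l + r) * (2 + l)
      expand = solve-∀

    r≡0 : ∀ r → suc l * suc l + r ≡ order F → r ≡ 0
    r≡0 zero    eq = refl
    r≡0 (suc r) eq = contradiction (1+l∣r (suc r) eq) (>⇒∤ (r<1+l (suc r) eq))

-- Induction on the number of hyperedges, and the theorem

-- The bound `D` stays fixed while hyperedges are removed: degrees only decrease, so the hypothesis
-- on them is inherited. The parameter `s` makes the recursion structural.
colouring : ∀ {l D} → 1 ≤ l → n ≤ l * l + 3 * l →
  ∀ s (F : List (Subset n)) → length F ≤ s → IsLinearSpace l F → (∀ v → deg F v * l ≤ D) →
  ∃ λ (c : Subset n → Fin (suc D)) → ProperOn F c
colouring _ _ _ [] _ _ _ = (λ _ → Fin.zero) , λ ()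
colouring {n} {l} {D} 1≤l n≤ (suc s) F@(e₀ ∷ _) ∣F∣≤ S deg*l≤D
  with Any.any? (λ e → length (neighbours F e) ≤? D) F
... | yes few =
  let e , e∈F , few-e = find few
      ≢e? = λ f → ¬? (f ≟ˢ e)
  in greedy (s≤s few-e) (colouring 1≤l n≤ s (F without e)
       (s≤s⁻¹ (≤-trans (filter-notAll ≢e? F (lose e∈F λ e≢e → e≢e refl)) ∣F∣≤))
       (IsLinearSpace.filter-isLinearSpace S ≢e?)
       (λ v → ≤-trans (*-monoˡ-≤ l (∑-filter ≢e? F)) (deg*l≤D v)))
... | no ¬few = class p∈F 2+l≤ , class-proper p∈F 2+l≤
  where
  open Stuck S n≤ deg*l≤D (λ e∈F → ≰⇒> λ few → ¬few (lose e∈F few))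

  e₀-point : Nonempty e₀
  e₀-point = Any.satisfied (∑𝟙-any (_∈? e₀) {xs = allFin n} (≤-trans (s≤s z≤n)
    (≤-reflexive (sym (IsLinearSpace.∑𝟙-edge S (here refl))))))

  p∈F : Covered F (proj₁ e₀-point)
  p∈F = here (proj₂ e₀-point)

  open AffinePlane S regular (order≡ p∈F)

  -- The `l + 2` parallel classes fit into `D + 1` colours because `l + 1 ≤ l (l + 2) ≤ D`; the
  -- first inequality rests on `1 ≤ l`, that is, on `k ≥ 2`.
  2+l≤ : 2 + l ≤ suc D
  2+l≤ = s≤s (begin
    suc l        ≤⟨ n≤1+n (suc l) ⟩
    2 + l        ≡⟨ *-identityˡ (2 + l) ⟨
    1 * (2 + l)  ≤⟨ *-monoˡ-≤ (2 + l) 1≤l ⟩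
    l * (2 + l)  ≤⟨ D≥ (here refl) ⟩
    D            ∎)
    where open ≤-Reasoning

theorem5p2 : (n k : ℕ) → 2 ≤ k →
    (H : Hypergraph n) → Uniform k H → Linear H →
    n ≤ k ^ 2 + k ∸ 2 →
    chromaticIndex H ≤ Δ [ H ]₂ + 1
theorem5p2 n (suc l) (s≤s 1≤l) H uniform linear n≤ =
  subst (chromaticIndex H ≤_) (+-comm 1 D) (proj₂ (chromaticIndex-isLeast H) (suc D)
    (let c , proper = colouring 1≤l n≤′ (length (E H)) (E H) ≤-refl S deg*l≤D
     -- `colouring` colours subsets, whereas `Proper` speaks of positions; distinct positions hold
     -- distinct hyperedges.
     in c ∘ edge H , λ i j i≢j →
          proper (∈-lookup i) (∈-lookup j) (i≢j ∘ lookup-injective (distinct H) i j)))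
  where
  open Hypergraph
  D : ℕ
  D = Δ [ H ]₂

  S : IsLinearSpace l (E H)
  S = record { unique = distinct H ; uniform = uniform ; linear = linear }

  deg*l≤D : ∀ v → deg (E H) v * l ≤ D
  deg*l≤D v = begin
    deg (E H) v * l
      ≤⟨ IsLinearSpace.deg*l≤collinear S v ⟩
    (∑[ u ∈ allFin n ] 𝟙 (collinear? (E H) v u))
      ≡⟨ length-filter≡∑ (collinear? (E H) v) (allFin n) ⟨
    SimpleGraph.degree [ H ]₂ v
      ≤⟨ All.lookup (xs≤max 0 (map (SimpleGraph.degree [ H ]₂) (allFin n)))
           (∈-map⁺ (SimpleGraph.degree [ H ]₂) (∈-allFin v)) ⟩
    D ∎
    where open ≤-Reasoning

  -- With `k = l + 1`, `k² + k` equals `l² + 3l + 2`, so the truncated subtraction of 2 is exact.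
  n≤′ : n ≤ l * l + 3 * l
  n≤′ = subst (n ≤_) (trans (cong (_∸ 2) (shape l)) (m+n∸n≡m (l * l + 3 * l) 2)) n≤
    where
    shape : ∀ l → suc l * (suc l * 1) + suc l ≡ l * l + 3 * l + 2
    shape = solve-∀
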